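{- Let $\overset{\leftrightarrow}{K}_3-e$ denote the digraph obtained from the bioriented triangle $\overset{\leftrightarrow}{K}_3$ by deleting one arc $e$. Then $\text{mader}_{\vec{\chi}}(\overset{\leftrightarrow}{K}_3-e)=3$.
   Context: Digraphs are finite, have a nonempty vertex set, are loopless and have no parallel arcs, but may contain anti-parallel pairs of arcs $(x,y),(y,x)$ (digons). The bioriented triangle $\overset{\leftrightarrow}{K}_3$ is the digraph on three vertices containing all six possible arcs. An acyclic $k$-coloring of $D$ is a map $c:V(D)\to\{1,\dots,k\}$ such that each color class $c^{ -1}(i)$ induces an acyclic subdigraph (one with no directed cycle; a digon is a directed cycle of length 2). The dichromatic number $\vec{\chi}(D)$ is the smallest $k\in\mathbb{N}$ for which $D$ has an acyclic $k$-coloring. A subdivision of a digraph $F$ is any digraph obtained by replacing every arc $(x,y)$ of $F$ by a directed path from $x$ to $y$ (of length at least 1), where the subdivision paths of different arcs are internally vertex-disjoint (and their internal vertices are new vertices). A digraph $D$ contains a subdivision of $F$ if some subdigraph of $D$ is isomorphic to a subdivision of $F$. $\text{mader}_{\vec{\chi}}(F)$ denotes the smallest integer $k\ge 1$ such that every digraph $D$ with $\vec{\chi}(D)\ge k$ contains a subdivision of $F$ (it is known that such a $k$ exists for every digraph $F$). -}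

module Defs where

open import Data.Bool using (Bool; not; _∧_; T)
open import Data.Bool.Properties using (T-∧)
open import Data.Fin using (Fin; zero; suc; fromℕ; inject₁; _≟_)
open import Data.Nat using (ℕ; suc; _+_; _≤_)
open import Data.Product using (Σ-syntax; _×_; proj₁)
open import Data.Vec using (Vec; _∷_; _∷ʳ_; lookup; tabulate)
open import Function using (_∘_)
open import Function.Bundles using (Equivalence)
open import Function.Definitions using (Injective)
open import Relation.Binary.PropositionalEquality using (_≡_; refl)
open import Relation.Nullary using (¬_; does; no)

IsLeast : (ℕ → Set) → ℕ → Set
IsLeast P k = P k × (∀ j → P j → k ≤ j)

-- Vertices are labelled by a nonempty Fin.  Boolean adjacency rules out
-- parallel arcs; digons are allowed.
record Digraph : Set where
  field
    order-1  : ℕ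
    adjacent : Fin (suc order-1) → Fin (suc order-1) → Bool

  Vertex : Set
  Vertex = Fin (suc order-1)

  infix 4 _⟶_
  _⟶_ : Vertex → Vertex → Set
  x ⟶ y = T (adjacent x y)

  field
    loopless : ∀ x → ¬ (x ⟶ x)

open Digraph public using (Vertex)

record Arc (D : Digraph) : Set where
  constructor arc
  open Digraph D using (_⟶_)
  field
    source : Vertex D
    target : Vertex D
    isArc  : source ⟶ target

open Arc public

infixl 6 _-ᵃ_
_-ᵃ_ : (D : Digraph) → Arc D → Digraph
D -ᵃ e = record
  { order-1  = order-1
  ; adjacent = λ x y → adjacent x y ∧ not (does (x ≟ source e) ∧ does (y ≟ target e))
  ; loopless = λ x → loopless x ∘ proj₁ ∘ Equivalence.to T-∧
  }
  where open Digraph D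

biorientedTriangle : Digraph
biorientedTriangle = record
  { order-1  = 2
  ; adjacent = λ x y → not (does (x ≟ y))
  ; loopless = irrefl
  }
  where
  irrefl : (x : Fin 3) → ¬ T (not (does (x ≟ x)))
  irrefl x p with x ≟ x
  ... | no x≢x = x≢x refl

module _ (D : Digraph) where
  open Digraph D using (_⟶_)

  -- A directed cycle of the subdigraph induced by the vertices satisfying P.
  -- Its length is 2 + length-2, so digons are included; there are no loops.
  record DirectedCycleIn (P : Vertex D → Set) : Set where
    field
      length-2 : ℕ
      vertex   : Fin (2 + length-2) → Vertex D
      distinct : Injective _≡_ _≡_ vertex
      inside   : ∀ i → P (vertex i)
      step     : ∀ (i : Fin (1 + length-2)) → vertex (inject₁ i) ⟶ vertex (suc i)
      close    : vertex (fromℕ (1 + length-2)) ⟶ vertex zero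

  IsAcyclicColoring : (k : ℕ) → (Vertex D → Fin k) → Set
  IsAcyclicColoring k c = ∀ (i : Fin k) → ¬ DirectedCycleIn (λ v → c v ≡ i)

  AcyclicallyColorable : ℕ → Set
  AcyclicallyColorable k = Σ[ c ∈ (Vertex D → Fin k) ] IsAcyclicColoring k c

  IsDichromaticNumber : ℕ → Set
  IsDichromaticNumber = IsLeast AcyclicallyColorable

-- The subdivision of F in which the path replacing the arc a has ℓ a internal
-- vertices (and hence length 1 + ℓ a).  Up to isomorphism every subdivision of
-- F is of this form.  Internal vertices of different paths, and branch
-- vertices, are distinct because they are built by different constructors or
-- from different arguments.
module Subdivision (F : Digraph) (ℓ : Arc F → ℕ) where

  data SubVertex : Set where
    branch   : Vertex F → SubVertex
    internal : (a : Arc F) → Fin (ℓ a) → SubVertex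

  path : (a : Arc F) → Vec SubVertex (2 + ℓ a)
  path a = branch (source a) ∷ (tabulate (internal a) ∷ʳ branch (target a))

  data SubArc : SubVertex → SubVertex → Set where
    step : (a : Arc F) (i : Fin (1 + ℓ a)) →
           SubArc (lookup (path a) (inject₁ i)) (lookup (path a) (suc i))

-- A subdigraph of D isomorphic to a given digraph is the image of an injective
-- arc-preserving map (it need not be induced).
record ContainsSubdivision (D F : Digraph) : Set where
  open Digraph D using (_⟶_)
  field
    ℓ : Arc F → ℕ
  open Subdivision F ℓ
  field
    embed          : SubVertex → Vertex D
    embed-inj      : Injective _≡_ _≡_ embed
    embed-preserve : ∀ {u v} → SubArc u v → embed u ⟶ embed v

ForcesSubdivision : Digraph → ℕ → Set
ForcesSubdivision F k =
  ∀ (D : Digraph) (χ : ℕ) → IsDichromaticNumber D χ → k ≤ χ → ContainsSubdivision D F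

IsMaderNumber : Digraph → ℕ → Set
IsMaderNumber F = IsLeast (λ k → 1 ≤ k × ForcesSubdivision F k)

{-# OPTIONS --safe #-}
module Submission where

-- In a digraph that is not 2-colourable we look for a bow tie: two directed cycles
-- meeting exactly in b, together with a path from one to the other avoiding b.  This
-- is a subdivision of the bioriented triangle minus an arc, with b as the branch
-- vertex that lies on both digons.  By Menger's theorem, if D stays strongly
-- connected after the removal of any vertex then every b is the centre of a bow tie.
-- Otherwise some z cuts D - z into A and B with no arc from B to A.  Contract B into
-- z: a 2-colouring of the contraction and one of D[B + z] glue to one of D, while a
-- bow tie of the contraction with centre b ≢ z lifts to D, since only one of the two
-- cycles passes through z.  To keep the condition b ≢ z available, the induction
-- proves that the centre can be chosen different from any prescribed vertex w.

open import Data.Bool using (Bool; true; false; not; T; _∧_; if_then_else_) renaming (_≟_ to _≟ᵇ_)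
open import Data.Bool.Properties using (T?; T-irrelevant; ¬-not; not-¬)
open import Data.Empty using (⊥; ⊥-elim)
open import Data.Fin using (Fin; zero; suc; fromℕ; inject₁; _≟_)
open import Data.Fin.Properties using (any?; all?; injective⇒≤)
open import Data.Fin.Subset using (Subset; _∈_; _⊂_; _-_; ⊤)
open import Data.Fin.Subset.Induction using (⊂-wellFounded; Acc; acc)
open import Data.Fin.Subset.Properties using (∈⊤; x∈p⇒p-x⊂p; x∈p∧x≢y⇒x∈p-y)
open import Data.List using (List; []; _∷_; _++_; allFin; cartesianProduct; filter; length; lookup)
open import Data.List.Membership.Propositional using () renaming (_∈_ to _∈ˡ_)
open import Data.List.Membership.Propositional.Properties
  using (∈-allFin; ∈-cartesianProduct⁺; ∈-filter⁺; ∈-filter⁻; ∈-++⁺ˡ; ∈-++⁺ʳ; ∈-lookup; ∈-∃++)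
open import Data.List.Relation.Unary.All as All using (All; []; _∷_)
open import Data.List.Relation.Unary.All.Properties using (++⁻ˡ; ¬Any⇒All¬)
open import Data.List.Relation.Unary.AllPairs using ([]; _∷_)
open import Data.List.Relation.Unary.Any using (here; there)
open import Data.List.Relation.Unary.Unique.Propositional using (Unique)
open import Data.List.Relation.Unary.Unique.Propositional.Properties using (Unique[x∷xs]⇒x∉xs)
import Data.List.Membership.DecPropositional as DecMembership
import Data.Vec as Vec
open import Data.Nat using (ℕ; zero; suc; _+_; _≤_; z≤n; s≤s)
open import Data.Nat.Properties using (1+n≰n; ≤-trans; ≰⇒>)
open import Data.Product using (Σ-syntax; ∃; ∃-syntax; _×_; _,_; proj₁; proj₂)
open import Data.Sum using (_⊎_; inj₁; inj₂; [_,_]′)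
open import Function using (_∘_; flip; id)
open import Relation.Binary.PropositionalEquality
  using (_≡_; _≢_; refl; sym; trans; cong; subst)
open import Relation.Nullary using (¬_; Dec; yes; no; does)
open import Relation.Nullary.Decidable using (_×-dec_; _⊎-dec_; _→-dec_; ¬?; map′; from-yes)
open import Relation.Binary.Definitions using () renaming (Decidable to Decidable₂)
open import Relation.Unary using (Decidable)

open import Defs

-- Walks confined to a vertex set

module _ {V : Set} where

  -- Every vertex carries a proof of `P`, so disjointness of walks becomes disjointness of
  -- predicates, and walks can be reversed, cut and lifted without listing their vertices.
  data Walk (E : V → V → Set) (P : V → Set) : V → V → Set where
    [_]  : ∀ {x} → P x → Walk E P x x
    cons : ∀ {x y z} → P x → E x y → Walk E P y z → Walk E P x z

module _ {V : Set} {E : V → V → Set} {P : V → Set} where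

  first : ∀ {x y} → Walk E P x y → P x
  first [ p ]        = p
  first (cons p _ _) = p

  last : ∀ {x y} → Walk E P x y → P y
  last [ p ]        = p
  last (cons _ _ w) = last w

  infixr 5 _++ʷ_
  _++ʷ_ : ∀ {x y z} → Walk E P x y → Walk E P y z → Walk E P x z
  [ _ ]        ++ʷ w′ = w′
  cons p e w ++ʷ w′ = cons p e (w ++ʷ w′)

  snoc : ∀ {x y z} → Walk E P x y → E y z → P z → Walk E P x z
  snoc w e p = w ++ʷ cons (last w) e [ p ]

  map : ∀ {E′ : V → V → Set} {P′ : V → Set} {x y} → (∀ {u v} → P u → P v → E u v → E′ u v) →
        (∀ {v} → P v → P′ v) → Walk E P x y → Walk E′ P′ x y
  map f g [ p ]        = [ g p ]
  map f g (cons p e w) = cons (g p) (f p (first w) e) (map f g w)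

module _ {V : Set} {E : V → V → Set} {P : V → Set} where

  forward : ∀ {I : V → Set} {x y} → (∀ {u v} → P u → P v → E u v → I u → I v) →
            I x → Walk E P x y → Walk E (λ v → P v × I v) x y
  forward f i [ p ]        = [ p , i ]
  forward f i (cons p e w) = cons (p , i) e (forward f (f p (first w) e i) w)

  backward : ∀ {I : V → Set} {x y} → (∀ {u v} → P u → P v → E u v → I v → I u) →
             I y → Walk E P x y → Walk E (λ v → P v × I v) x y
  backward f i [ p ]        = [ p , i ]
  backward f i (cons p e w) = cons (p , f p (first w) e (proj₂ (first w′))) e w′
    where w′ = backward f i w

  -- In the second alternative the arcs are limited to those with tail outside `S`. This says that
  -- no vertex before the last one, `c`, lies in `S`.
  firstHit : ∀ {S : V → Set} {x y} → Decidable S → Walk E P x y →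
             Walk E (λ v → P v × ¬ S v) x y ⊎
             ∃[ c ] S c × Walk (λ u v → ¬ S u × E u v) P x c
  firstHit {x = x} S? w with S? x
  ... | yes s = inj₂ (x , s , [ first w ])
  firstHit S? [ p ]        | no ¬s = inj₁ [ p , ¬s ]
  firstHit S? (cons p e w) | no ¬s with firstHit S? w
  ... | inj₁ w′           = inj₁ (cons (p , ¬s) e w′)
  ... | inj₂ (c , s , w′) = inj₂ (c , s , cons p (¬s , e) w′)

  lastExit : ∀ {S : V → Set} {x y} → Decidable S → ¬ S y → Walk E P x y →
             Walk E (λ v → P v × ¬ S v) x y ⊎
             ∃[ a ] ∃[ t ] S a × E a t × Walk E (λ v → P v × ¬ S v) t y
  lastExit S? ¬s [ p ] = inj₁ [ p , ¬s ]
  lastExit S? ¬s (cons {x} p e w) with lastExit S? ¬s w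
  ... | inj₂ r = inj₂ r
  ... | inj₁ w′ with S? x
  ...   | yes s  = inj₂ (_ , _ , s , e , w′)
  ...   | no ¬s′ = inj₁ (cons (p , ¬s′) e w′)

  firstEntry : ∀ {S : V → Set} {x y} → Decidable S → ¬ S x → S y → Walk E P x y →
               ∃[ t ] ∃[ c ] Walk E (λ v → P v × ¬ S v) x t × E t c × S c
  firstEntry S? ¬s s [ _ ] = ⊥-elim (¬s s)
  firstEntry S? ¬s s (cons {y = y} p e w) with S? y
  ... | yes s′ = _ , _ , [ p , ¬s ] , e , s′
  ... | no ¬s′ with firstEntry S? ¬s′ s w
  ...   | _ , _ , w′ , e′ , s′ = _ , _ , cons (p , ¬s) e w′ , e′ , s′

  splitAt : ∀ {S : V → Set} {x y} → Decidable S → Walk E P x y →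
            Walk E (λ v → P v × ¬ S v) x y ⊎
            ∃[ c ] S c × Walk E P x c × Walk E P c y
  splitAt {x = x} S? w with S? x
  ... | yes s = inj₂ (x , s , [ first w ] , w)
  splitAt S? [ p ]        | no ¬s = inj₁ [ p , ¬s ]
  splitAt S? (cons p e w) | no ¬s with splitAt S? w
  ... | inj₁ w′                = inj₁ (cons (p , ¬s) e w′)
  ... | inj₂ (c , s , w₁ , w₂) = inj₂ (c , s , cons p e w₁ , w₂)

module _ {V : Set} {P : V → Set} where

  reverse : ∀ {E x y} → Walk E P x y → Walk (flip E) P y x
  reverse [ p ]        = [ p ]
  reverse (cons p e w) = snoc (reverse w) e p

-- Reachability

module _ {V : Set} where

  infixl 5 _⊕_
  _⊕_ : (V → V → Set) → V × V → V → V → Set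
  (E ⊕ (x , y)) u v = E u v ⊎ (u ≡ x × v ≡ y)

  FromArcs : List (V × V) → V → V → Set
  FromArcs []      = λ _ _ → ⊥
  FromArcs (e ∷ L) = FromArcs L ⊕ e

  -- If the walk uses the new arc, the part before its first use and the part after its last use are
  -- walks of `E`.
  ⊕-split : ∀ {E P x y u v} → Walk (E ⊕ (x , y)) P u v →
            Walk E P u v ⊎ (Walk E P u x × Walk E P y v)
  ⊕-split [ p ] = inj₁ [ p ]
  ⊕-split (cons p e w) with e | ⊕-split w
  ... | inj₁ e′            | inj₁ w′        = inj₁ (cons p e′ w′)
  ... | inj₁ e′            | inj₂ (w₁ , w₂) = inj₂ (cons p e′ w₁ , w₂)
  ... | inj₂ (refl , refl) | inj₁ w′        = inj₂ ([ p ] , w′)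
  ... | inj₂ (refl , refl) | inj₂ (_ , w₂)  = inj₂ ([ p ] , w₂)

  ⊕-join : ∀ {E P x y u v} → Walk E P u x → Walk E P y v → Walk (E ⊕ (x , y)) P u v
  ⊕-join w₁ w₂ =
    map (λ _ _ → inj₁) id w₁ ++ʷ cons (last w₁) (inj₂ (refl , refl)) (map (λ _ _ → inj₁) id w₂)

module _ {n : ℕ} where

  private
    V = Fin n

  -- By `⊕-split` and `⊕-join`, recursion on the list of arcs decides reachability without a bound
  -- on the lengths of walks.
  fromArcs-walk? : ∀ {P : V → Set} → Decidable P → ∀ L u v → Dec (Walk (FromArcs L) P u v)
  fromArcs-walk? P? [] u v with u ≟ v | P? u
  ... | yes refl | yes p = yes [ p ]
  ... | yes refl | no ¬p = no (¬p ∘ first)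
  ... | no u≢v   | _     = no λ { [ _ ] → u≢v refl }
  fromArcs-walk? P? ((x , y) ∷ L) u v =
    map′ [ map (λ _ _ → inj₁) id , (λ (w₁ , w₂) → ⊕-join w₁ w₂) ]′ ⊕-split
      (walk? u v ⊎-dec (walk? u x ×-dec walk? y v))
    where walk? = fromArcs-walk? P? L

  -- Menger's theorem for two disjoint walks, by Göring's induction on the arcs.

  record TwoWalks (E : V → V → Set) (A B : V → Set) : Set₁ where
    field
      P Q           : V → Set
      disjoint      : ∀ {v} → P v → ¬ Q v
      {p₀ p₁ q₀ q₁} : V
      a∈A           : A p₀
      b∈B           : B p₁
      a′∈A          : A q₀
      b′∈B          : B q₁
      p-walk        : Walk E P p₀ p₁
      q-walk        : Walk E Q q₀ q₁

  open TwoWalks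

  Separates : (V → V → Set) → (V → Set) → (V → Set) → V → Set
  Separates E A B s = ∀ {a b} → A a → B b → ¬ Walk E (_≢ s) a b

  twoWalks-flip : ∀ {E A B} → TwoWalks E A B → TwoWalks (flip E) B A
  twoWalks-flip t = record
    { disjoint = t .disjoint
    ; a∈A = t .b∈B ; b∈B = t .a∈A ; a′∈A = t .b′∈B ; b′∈B = t .a′∈A
    ; p-walk = reverse (t .p-walk) ; q-walk = reverse (t .q-walk) }

  Reach : (V → V → Set) → (V → Set) → V → V → Set
  Reach E A s v = ∃[ a ] A a × Walk E (_≢ s) a v

  Pair : V → V → V → Set
  Pair s x v = v ≡ s ⊎ v ≡ x

  -- One half of the gluing in Göring's proof: disjoint walks from `A` to `s` and to `x` that stay,
  -- apart from `s` itself, on the side of `s` reachable from `A`.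
  record Fan (E : V → V → Set) (A : V → Set) (s x : V) : Set₁ where
    field
      P Q      : V → Set
      disjoint : ∀ {v} → P v → ¬ Q v
      P⊆Reach  : ∀ {v} → P v → Reach E A s v
      Q⊆Reach  : ∀ {v} → Q v → Reach E A s v
      s-walk   : ∃[ a ] A a × Walk E (λ v → v ≡ s ⊎ P v) a s
      x-walk   : ∃[ a ] A a × Walk E Q a x

  -- The first walk is cut at its first visit to `s`. The second never meets `s`, because the first
  -- one ends there. Hence every vertex used other than `s` is reached from `A` around `s`.
  fan : ∀ {E A s x a a′} {P Q : V → Set} → (∀ {v} → P v → ¬ Q v) →
        A a → A a′ → Walk E P a s → Walk E Q a′ x → Fan E A s x
  fan {E} {A} {s} {x} {a} {a′} {P} {Q} P∩Q=∅ a∈A a′∈A p q = record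
    { disjoint = λ (_ , pv) (_ , qv) → P∩Q=∅ pv qv
    ; P⊆Reach  = proj₁
    ; Q⊆Reach  = proj₁
    ; s-walk   = a , a∈A , cut (firstHit (_≟ s) p)
    ; x-walk   = a′ , a′∈A ,
        map (λ _ _ e → e) (λ (qv , r) → r , qv)
          (forward (λ _ qv e (_ , aA , w) → _ , aA , snoc w e (Q≢s qv))
                   (_ , a′∈A , [ Q≢s (first q) ]) q)
    }
    where
    Q≢s : ∀ {v} → Q v → v ≢ s
    Q≢s qs refl = P∩Q=∅ (last p) qs

    Inv : V → Set
    Inv v = v ≡ s ⊎ Reach E A s v

    P′ : V → Set
    P′ v = v ≡ s ⊎ (Reach E A s v × P v)

    start : Inv a
    start with a ≟ s
    ... | yes a≡s = inj₁ a≡s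
    ... | no a≢s  = inj₂ (_ , a∈A , [ a≢s ])

    step : ∀ {u v} → P u → P v → u ≢ s × E u v → Inv u → Inv v
    step _ _ (u≢s , _) (inj₁ u≡s) = ⊥-elim (u≢s u≡s)
    step {v = v} _ _ (_ , e) (inj₂ (_ , aA , w)) with v ≟ s
    ... | yes v≡s = inj₁ v≡s
    ... | no v≢s  = inj₂ (_ , aA , snoc w e v≢s)

    cut : Walk E (λ v → P v × v ≢ s) a s ⊎
          ∃[ c ] c ≡ s × Walk (λ u v → u ≢ s × E u v) P a c → Walk E P′ a s
    cut (inj₁ w) = ⊥-elim (proj₂ (last w) refl)
    cut (inj₂ (_ , refl , w)) =
      map (λ _ _ → proj₂)
          (λ { (_ , inj₁ v≡s) → inj₁ v≡s ; (pv , inj₂ r) → inj₂ (r , pv) })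
          (forward step start w)

  twoWalks⇒fan : ∀ {E A s x} → TwoWalks E A (Pair s x) → Fan E A s x
  twoWalks⇒fan t with t .b∈B | t .b′∈B
  ... | inj₁ refl | inj₁ refl = ⊥-elim (t .disjoint (last (t .p-walk)) (last (t .q-walk)))
  ... | inj₁ refl | inj₂ refl = fan (t .disjoint) (t .a∈A) (t .a′∈A) (t .p-walk) (t .q-walk)
  ... | inj₂ refl | inj₁ refl = fan (flip (t .disjoint)) (t .a′∈A) (t .a∈A) (t .q-walk) (t .p-walk)
  ... | inj₂ refl | inj₂ refl = ⊥-elim (t .disjoint (last (t .p-walk)) (last (t .q-walk)))

  -- The two sides of the separator are disjoint, since a common vertex would give a walk from `A`
  -- to `B` around `s`. So the fans meet only in `s`: two of their walks are joined there, the other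
  -- two through the new arc.
  joinFans : ∀ {E A B s x y} → Separates E A B s →
             Fan E A s x → Fan (flip E) B s y → TwoWalks (E ⊕ (x , y)) A B
  joinFans {E} {A} {B} {s} sep f g = record
    { P        = λ v → v ≡ s ⊎ (F.P v ⊎ G.P v)
    ; Q        = λ v → F.Q v ⊎ G.Q v
    ; disjoint = disj
    ; a∈A      = proj₁ (proj₂ F.s-walk)
    ; b∈B      = proj₁ (proj₂ G.s-walk)
    ; a′∈A     = proj₁ (proj₂ F.x-walk)
    ; b′∈B     = proj₁ (proj₂ G.x-walk)
    ; p-walk   = map (λ _ _ → inj₁) [ inj₁ , inj₂ ∘ inj₁ ]′ (proj₂ (proj₂ F.s-walk)) ++ʷ
                 map (λ _ _ → inj₁) [ inj₁ , inj₂ ∘ inj₂ ]′ (reverse (proj₂ (proj₂ G.s-walk)))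
    ; q-walk   = ⊕-join (map (λ _ _ e → e) inj₁ (proj₂ (proj₂ F.x-walk)))
                        (map (λ _ _ e → e) inj₂ (reverse (proj₂ (proj₂ G.x-walk))))
    }
    where
    module F = Fan f
    module G = Fan g

    s∉Reach : ∀ {E A} → ¬ Reach E A s s
    s∉Reach (_ , _ , w) = last w refl

    meet : ∀ {v} → Reach E A s v → ¬ Reach (flip E) B s v
    meet (_ , a∈A , w) (_ , b∈B , w′) = sep a∈A b∈B (w ++ʷ reverse w′)

    disj : ∀ {v} → v ≡ s ⊎ (F.P v ⊎ G.P v) → ¬ (F.Q v ⊎ G.Q v)
    disj (inj₁ refl)     (inj₁ q) = s∉Reach (F.Q⊆Reach q)
    disj (inj₁ refl)     (inj₂ q) = s∉Reach (G.Q⊆Reach q)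
    disj (inj₂ (inj₁ p)) (inj₁ q) = F.disjoint p q
    disj (inj₂ (inj₁ p)) (inj₂ q) = meet (F.P⊆Reach p) (G.Q⊆Reach q)
    disj (inj₂ (inj₂ p)) (inj₁ q) = meet (F.Q⊆Reach q) (G.P⊆Reach p)
    disj (inj₂ (inj₂ p)) (inj₂ q) = G.disjoint p q

  separates-flip : ∀ {E A B s} → Separates E A B s → Separates (flip E) B A s
  separates-flip sep b∈B a∈A = sep a∈A b∈B ∘ reverse

  separates-⊕ : ∀ {E A B s x y v} → Separates E A B s → Separates E A (Pair s x) v →
                Separates (E ⊕ (x , y)) A B v
  separates-⊕ {E} {s = s} {x} {y} sep-s sep-v a∈A b∈B w
    with firstHit (λ v → (v ≟ s) ⊎-dec (v ≟ x)) w
  ... | inj₁ w′ = sep-s a∈A b∈B (map noNew (λ (_ , ∉) → ∉ ∘ inj₁) w′)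
    where
    noNew : ∀ {u t} → (u ≢ _ × ¬ Pair s x u) → (t ≢ _ × ¬ Pair s x t) → (E ⊕ (x , y)) u t → E u t
    noNew _       _ (inj₁ e)          = e
    noNew (_ , ∉) _ (inj₂ (refl , _)) = ⊥-elim (∉ (inj₂ refl))
  ... | inj₂ (_ , c∈ , w′) = sep-v a∈A c∈ (map noNew id w′)
    where
    noNew : ∀ {u t} → u ≢ _ → t ≢ _ → ¬ Pair s x u × (E ⊕ (x , y)) u t → E u t
    noNew _ _ (_ , inj₁ e)          = e
    noNew _ _ (∉ , inj₂ (refl , _)) = ⊥-elim (∉ (inj₂ refl))

  -- If `s` separates before the arc from `x` to `y` is added, two walks are sought from `A` to `s`
  -- and `x`, and two from `s` and `y` to `B`. Either both pairs exist and are joined, or a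
  -- separator for one of these problems separates `A` from `B` as well.
  fromArcs-menger : V → ∀ L {A B} → Decidable A → Decidable B →
                    TwoWalks (FromArcs L) A B ⊎ ∃ (Separates (FromArcs L) A B)
  fromArcs-menger v₀ [] A? B? with any? (λ v → A? v ×-dec B? v)
  -- Without arcs a walk is a single vertex of `A` and `B`. If there is none, every vertex
  -- separates, and `v₀` is taken.
  ... | no none = inj₂ (v₀ , λ { a∈A a∈B [ _ ] → none (_ , a∈A , a∈B) })
  ... | yes (a , a∈A , a∈B) with any? (λ v → ¬? (v ≟ a) ×-dec (A? v ×-dec B? v))
  ...   | no none = inj₂ (a , λ { x∈A x∈B [ x≢a ] → none (_ , x≢a , x∈A , x∈B) })
  ...   | yes (a′ , a′≢a , a′∈A , a′∈B) = inj₁ record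
    { P = _≡ a ; Q = _≡ a′ ; disjoint = λ { refl refl → a′≢a refl }
    ; a∈A = a∈A ; b∈B = a∈B ; a′∈A = a′∈A ; b′∈B = a′∈B
    ; p-walk = [ refl ] ; q-walk = [ refl ] }
  fromArcs-menger v₀ ((x , y) ∷ L) A? B? with fromArcs-menger v₀ L A? B?
  ... | inj₁ t = inj₁ record
    { disjoint = t .disjoint
    ; a∈A = t .a∈A ; b∈B = t .b∈B ; a′∈A = t .a′∈A ; b′∈B = t .b′∈B
    ; p-walk = map (λ _ _ → inj₁) id (t .p-walk) ; q-walk = map (λ _ _ → inj₁) id (t .q-walk) }
  ... | inj₂ (s , sep)
    with fromArcs-menger v₀ L A? (λ v → (v ≟ s) ⊎-dec (v ≟ x))
       | fromArcs-menger v₀ L (λ v → (v ≟ s) ⊎-dec (v ≟ y)) B?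
  ...   | inj₂ (v , sep′) | _ = inj₂ (v , separates-⊕ sep sep′)
  -- The mirror case: in the reversed digraph the new arc runs from `y` to `x`.
  ...   | inj₁ _ | inj₂ (v , sep′) = inj₂ (v , λ a∈A b∈B w →
          separates-⊕ {y = x} (separates-flip sep) (separates-flip sep′) b∈B a∈A
            (map (λ { _ _ (inj₁ e) → inj₁ e ; _ _ (inj₂ (p , q)) → inj₂ (q , p) }) id (reverse w)))
  ...   | inj₁ t | inj₁ t′ =
          inj₁ (joinFans sep (twoWalks⇒fan t) (twoWalks⇒fan (twoWalks-flip t′)))

  ∈⇒fromArcs : ∀ {L} {u v : V} → (u , v) ∈ˡ L → FromArcs L u v
  ∈⇒fromArcs (here refl) = inj₂ (refl , refl)
  ∈⇒fromArcs (there ∈L)  = inj₁ (∈⇒fromArcs ∈L)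

  fromArcs⇒∈ : ∀ {L} {u v : V} → FromArcs L u v → (u , v) ∈ˡ L
  fromArcs⇒∈ {_ ∷ _} (inj₁ e)             = there (fromArcs⇒∈ e)
  fromArcs⇒∈ {_ ∷ _} (inj₂ (refl , refl)) = here refl

  module _ {E : V → V → Set} (E? : Decidable₂ E) where

    private
      E?′ : Decidable (λ ((u , v) : V × V) → E u v)
      E?′ (u , v) = E? u v

      arcs : List (V × V)
      arcs = filter E?′ (cartesianProduct (allFin n) (allFin n))

      to : ∀ {u v} → E u v → FromArcs arcs u v
      to e = ∈⇒fromArcs (∈-filter⁺ E?′ (∈-cartesianProduct⁺ (∈-allFin _) (∈-allFin _)) e)

      from : ∀ {u v} → FromArcs arcs u v → E u v
      from e = proj₂ (∈-filter⁻ E?′ {xs = cartesianProduct (allFin n) (allFin n)} (fromArcs⇒∈ e))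

    walk? : ∀ {P : V → Set} → Decidable P → Decidable₂ (Walk E P)
    walk? P? u v = map′ (map (λ _ _ → from) id) (map (λ _ _ → to) id) (fromArcs-walk? P? arcs u v)

    menger : V → ∀ {A B} → Decidable A → Decidable B → TwoWalks E A B ⊎ ∃ (Separates E A B)
    menger v₀ A? B? with fromArcs-menger v₀ arcs A? B?
    ... | inj₁ t = inj₁ record
      { disjoint = t .disjoint
      ; a∈A = t .a∈A ; b∈B = t .b∈B ; a′∈A = t .a′∈A ; b′∈B = t .b′∈B
      ; p-walk = map (λ _ _ → from) id (t .p-walk) ; q-walk = map (λ _ _ → from) id (t .q-walk) }
    ... | inj₂ (s , sep) = inj₂ (s , λ a∈A b∈B → sep a∈A b∈B ∘ map (λ _ _ → to) id)

-- Two-colourings and bow ties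

module _ {n : ℕ} where

  private
    V = Fin n

  -- Monochromatic closed walks, each an arc with a walk back, stand in for cycles: they can be
  -- rotated and contracted without regard to repeated vertices.
  Acyclic : (V → V → Set) → (V → Bool) → Set
  Acyclic E c = ∀ {k x y} → E x y → ¬ Walk E (λ v → c v ≡ k) y x

  TwoColorable : (V → V → Set) → Set
  TwoColorable E = ∃ (Acyclic E)

  -- Two closed walks through b that are otherwise disjoint, and a walk avoiding b
  -- from the first to the second: up to shortcuts, a subdivision with hub b.
  record BowTie (E : V → V → Set) (b : V) : Set₁ where
    field
      P Q           : V → Set
      disjoint      : ∀ {v} → P v → ¬ Q v
      b∉P           : ¬ P b
      b∉Q           : ¬ Q b
      {x₁ y₁ x₂ y₂} : V
      b⟶x₁          : E b x₁
      y₁⟶b          : E y₁ b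
      b⟶x₂          : E b x₂
      y₂⟶b          : E y₂ b
      p-walk        : Walk E P x₁ y₁
      q-walk        : Walk E Q x₂ y₂
      link          : Walk E (_≢ b) x₁ y₂

  open TwoWalks
  open BowTie

  Outcome : (V → V → Set) → V → Set₁
  Outcome E w = TwoColorable E ⊎ (∃[ b ] b ≢ w × BowTie E b)

  -- The vertex type stays `Fin n`. A smaller digraph is one whose arcs lie inside a smaller `U`,
  -- and the induction descends on `U`.
  Supported : Subset n → (V → V → Set) → Set
  Supported U E = ∀ {x y} → E x y → x ∈ U × y ∈ U

  Solves : Subset n → Set₁
  Solves U = ∀ {E} → Decidable₂ E → (∀ {x} → ¬ E x x) → Supported U E → ∀ w → Outcome E w

  bowTie-mono : ∀ {E E′ : V → V → Set} {b} → (∀ {x y} → E x y → E′ x y) → BowTie E b → BowTie E′ b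
  bowTie-mono E⊆E′ t = record
    { disjoint = t .disjoint ; b∉P = t .b∉P ; b∉Q = t .b∉Q
    ; b⟶x₁ = E⊆E′ (t .b⟶x₁) ; y₁⟶b = E⊆E′ (t .y₁⟶b)
    ; b⟶x₂ = E⊆E′ (t .b⟶x₂) ; y₂⟶b = E⊆E′ (t .y₂⟶b)
    ; p-walk = map (λ _ _ → E⊆E′) id (t .p-walk)
    ; q-walk = map (λ _ _ → E⊆E′) id (t .q-walk)
    ; link = map (λ _ _ → E⊆E′) id (t .link) }

  bowTie-flip : ∀ {E : V → V → Set} {b} → BowTie E b → BowTie (flip E) b
  bowTie-flip t = record
    { disjoint = flip (t .disjoint) ; b∉P = t .b∉Q ; b∉Q = t .b∉P
    ; b⟶x₁ = t .y₂⟶b ; y₁⟶b = t .b⟶x₂ ; b⟶x₂ = t .y₁⟶b ; y₂⟶b = t .b⟶x₁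
    ; p-walk = reverse (t .q-walk) ; q-walk = reverse (t .p-walk) ; link = reverse (t .link) }

  acyclic-flip : ∀ {E : V → V → Set} {c} → Acyclic E c → Acyclic (flip E) c
  acyclic-flip acyclic e w = acyclic e (reverse w)

  outcome-flip : ∀ {E : V → V → Set} {w} → Outcome E w → Outcome (flip E) w
  outcome-flip (inj₁ (c , acyclic))  = inj₁ (c , acyclic-flip acyclic)
  outcome-flip (inj₂ (b , b≢w , t)) = inj₂ (b , b≢w , bowTie-flip t)

  not-injective : ∀ {p q} → not p ≡ q → p ≡ not q
  not-injective {false} refl = refl
  not-injective {true}  refl = refl

  recolor : ∀ {E : V → V → Set} → TwoColorable E → ∀ v k → Σ[ c ∈ (V → Bool) ] Acyclic E c × c v ≡ k
  recolor (c , acyclic) v k with c v ≟ᵇ k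
  ... | yes cv≡k = c , acyclic , cv≡k
  ... | no cv≢k  = not ∘ c
                 , (λ e w → acyclic e (map (λ _ _ e → e) not-injective w))
                 , sym (¬-not (cv≢k ∘ sym))

  -- Reduction along a cut vertex

  module Cut
    {E : V → V → Set} (E? : Decidable₂ E) (loopless : ∀ {x} → ¬ E x x)
    {U : Subset n} (supp : Supported U E) (ih : ∀ {U′} → U′ ⊂ U → Solves U′)
    {B : V → Set} (B? : Decidable B) {z : V} (z∉B : ¬ B z)
    (closed : ∀ {u v} → B u → E u v → B v ⊎ v ≡ z)
    (inner : ∃[ i ] i ∈ U × B i)
    (outer : ∃[ o ] o ∈ U × ¬ B o × o ≢ z)
    where

    Outside : V → Set
    Outside v = ¬ B v × v ≢ z

    Bz : V → Set
    Bz v = B v ⊎ v ≡ z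

    Bz? : Decidable Bz
    Bz? v = B? v ⊎-dec (v ≟ z)

    Detour : V → V → Set
    Detour x v = E x v × B v × Walk E Bz v z

    Contracted : V → V → Set
    Contracted x y = (¬ B x × ¬ B y × E x y) ⊎ (y ≡ z × Outside x × ∃ (Detour x))

    contracted? : Decidable₂ Contracted
    contracted? x y =
      (¬? (B? x) ×-dec (¬? (B? y) ×-dec E? x y)) ⊎-dec
      ((y ≟ z) ×-dec ((¬? (B? x) ×-dec ¬? (x ≟ z)) ×-dec
        any? (λ v → E? x v ×-dec (B? v ×-dec walk? E? Bz? v z))))

    Restricted : V → V → Set
    Restricted x y = Bz x × Bz y × E x y

    restricted? : Decidable₂ Restricted
    restricted? x y = Bz? x ×-dec (Bz? y ×-dec E? x y)

    contracted-source : ∀ {x y} → Contracted x y → ¬ B x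
    contracted-source (inj₁ (x∉B , _))         = x∉B
    contracted-source (inj₂ (_ , (x∉B , _) , _)) = x∉B

    contracted-target : ∀ {x y} → Contracted x y → ¬ B y
    contracted-target (inj₁ (_ , y∉B , _)) = y∉B
    contracted-target (inj₂ (refl , _))    = z∉B

    -- The prescribed vertex is `z`, so that the centre of a bow tie differs from `z`, as
    -- `lift-bowTie` requires. The support loses a vertex of `B`.
    contracted-outcome : Outcome Contracted z
    contracted-outcome = ih (x∈p⇒p-x⊂p i∈U) contracted? loopless′ supp′ z
      where
      i = proj₁ inner
      i∈U = proj₁ (proj₂ inner)
      i∈B = proj₂ (proj₂ inner)

      loopless′ : ∀ {x} → ¬ Contracted x x
      loopless′ (inj₁ (_ , _ , e))          = loopless e
      loopless′ (inj₂ (x≡z , (_ , x≢z) , _)) = x≢z x≡z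

      walk-supp : ∀ {P x y} → x ∈ U → Walk E P x y → y ∈ U
      walk-supp x∈U [ _ ]        = x∈U
      walk-supp x∈U (cons _ e w) = walk-supp (proj₂ (supp e)) w

      supp″ : ∀ {x y} → Contracted x y → x ∈ U × y ∈ U
      supp″ (inj₁ (_ , _ , e))                   = supp e
      supp″ (inj₂ (refl , _ , _ , e , _ , detour)) =
        proj₁ (supp e) , walk-supp (proj₂ (supp e)) detour

      B≢ : ∀ {x} → ¬ B x → x ≢ i
      B≢ x∉B refl = x∉B i∈B

      supp′ : Supported (U - i) Contracted
      supp′ e = x∈p∧x≢y⇒x∈p-y (proj₁ (supp″ e)) (B≢ (contracted-source e))
              , x∈p∧x≢y⇒x∈p-y (proj₂ (supp″ e)) (B≢ (contracted-target e))

    restricted-outcome : ∀ w → Outcome Restricted w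
    restricted-outcome = ih (x∈p⇒p-x⊂p (proj₁ (proj₂ outer))) restricted?
      (λ (_ , _ , e) → loopless e)
      (λ (x∈ , y∈ , e) → x∈p∧x≢y⇒x∈p-y (proj₁ (supp e)) (Bz≢ x∈)
                       , x∈p∧x≢y⇒x∈p-y (proj₂ (supp e)) (Bz≢ y∈))
      where
      Bz≢ : ∀ {x} → Bz x → x ≢ proj₁ outer
      Bz≢ (inj₁ x∈B) refl = proj₁ (proj₂ (proj₂ outer)) x∈B
      Bz≢ (inj₂ x≡z) refl = proj₂ (proj₂ (proj₂ outer)) x≡z

    -- A walk of the contracted digraph lifts to E; only a walk through z needs
    -- vertices of B, so disjointness survives.
    Lifted : (V → Set) → V → Set
    Lifted P v = (¬ B v × P v) ⊎ (B v × P z)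

    lift-detour : ∀ {P v} → P z → Walk E Bz v z → Walk E (Lifted P) v z
    lift-detour pz = map (λ _ _ e → e)
      λ { (inj₁ v∈B) → inj₂ (v∈B , pz) ; (inj₂ refl) → inj₁ (z∉B , pz) }

    lift : ∀ {P x y} → ¬ B x → Walk Contracted P x y → Walk E (Lifted P) x y
    lift x∉B [ p ] = [ inj₁ (x∉B , p) ]
    lift x∉B (cons p (inj₁ (_ , y∉B , e)) w) = cons (inj₁ (x∉B , p)) e (lift y∉B w)
    lift x∉B (cons p (inj₂ (refl , _ , _ , e , _ , detour)) w) =
      cons (inj₁ (x∉B , p)) e (lift-detour (first w) detour ++ʷ lift z∉B w)

    lift-arc : ∀ {b x} → Contracted b x →
               ∃[ x′ ] E b x′ × (∀ {P y} → Walk Contracted P x y → Walk E (Lifted P) x′ y)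
    lift-arc (inj₁ (_ , x∉B , e)) = _ , e , lift x∉B
    lift-arc (inj₂ (refl , _ , x′ , e , _ , detour)) =
      x′ , e , λ w → lift-detour (first w) detour ++ʷ lift z∉B w

    -- New arcs end in `z`, so the arcs into `b` are old. An arc out of `b` may be new; its detour
    -- then becomes the beginning of the lifted walk. Detours run in `B` and `z`, hence avoid `b`.
    lift-bowTie : ∀ {b} → b ≢ z → BowTie Contracted b → BowTie E b
    lift-bowTie {b} b≢z t with lift-arc (t .b⟶x₁) | lift-arc (t .b⟶x₂)
    ... | _ , e₁ , lift₁ | _ , e₂ , lift₂ = record
      { disjoint = λ
          { (inj₁ (_ , p))   (inj₁ (_ , q))   → t .disjoint p q
          ; (inj₁ (v∉B , _)) (inj₂ (v∈B , _)) → v∉B v∈B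
          ; (inj₂ (v∈B , _)) (inj₁ (v∉B , _)) → v∉B v∈B
          ; (inj₂ (_ , p))   (inj₂ (_ , q))   → t .disjoint p q }
      ; b∉P    = b∉Lifted {t .P} (t .b∉P)
      ; b∉Q    = b∉Lifted {t .Q} (t .b∉Q)
      ; b⟶x₁   = e₁
      ; y₁⟶b   = old (t .y₁⟶b)
      ; b⟶x₂   = e₂
      ; y₂⟶b   = old (t .y₂⟶b)
      ; p-walk = lift₁ (t .p-walk)
      ; q-walk = lift₂ (t .q-walk)
      ; link   = map (λ _ _ e → e)
                   (λ { (inj₁ (_ , v≢b)) → v≢b ; (inj₂ (v∈B , _)) refl → b∉B v∈B })
                   (lift₁ (t .link))
      }
      where
      b∉B : ¬ B b
      b∉B = contracted-source (t .b⟶x₁)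

      b∉Lifted : ∀ {P : V → Set} → ¬ P b → ¬ Lifted P b
      b∉Lifted b∉P (inj₁ (_ , p))   = b∉P p
      b∉Lifted b∉P (inj₂ (b∈B , _)) = b∉B b∈B

      old : ∀ {y} → Contracted y b → E y b
      old (inj₁ (_ , _ , e)) = e
      old (inj₂ (b≡z , _))   = ⊥-elim (b≢z b≡z)

    -- After a possible swap the two colourings agree at `z`. A monochromatic closed walk inside `B`
    -- and `z` contradicts the second one. Any other can be started outside `B`; its excursions into
    -- `B` come back through `z` and are replaced by new arcs, which contradicts the first one.
    glue : TwoColorable Contracted → TwoColorable Restricted → TwoColorable E
    glue (c₁ , acyclic₁) colorable₂ = c , acyclic
      where
      r  = recolor colorable₂ z (c₁ z)
      c₂ = proj₁ r

      c : V → Bool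
      c v with B? v
      ... | yes _ = c₂ v
      ... | no  _ = c₁ v

      c-outer : ∀ {v} → ¬ B v → c v ≡ c₁ v
      c-outer {v} v∉B with B? v
      ... | yes v∈B = ⊥-elim (v∉B v∈B)
      ... | no _    = refl

      c-inner : ∀ {v} → Bz v → c v ≡ c₂ v
      c-inner {v} v∈ with B? v
      c-inner v∈         | yes _   = refl
      c-inner (inj₁ v∈B) | no v∉B  = ⊥-elim (v∉B v∈B)
      c-inner (inj₂ refl) | no _    = sym (proj₂ (proj₂ r))

      module _ {k : Bool} where

        Mono Mono₁ : V → Set
        Mono v  = c v ≡ k
        Mono₁ v = c₁ v ≡ k

        no-inner : ∀ {x y} → Bz x → E x y → ¬ Walk E (λ v → Mono v × Bz v) y x
        no-inner x∈ e w = proj₁ (proj₂ r) (x∈ , proj₂ (first w) , e)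
          (map (λ (_ , u∈) (_ , v∈) e → u∈ , v∈ , e)
               (λ (cv≡k , v∈) → trans (sym (c-inner v∈)) cv≡k) w)

        mono₁ : ∀ {v} → ¬ B v → Mono v → Mono₁ v
        mono₁ v∉B = trans (sym (c-outer v∉B))

        mutual
          contract : ∀ {x y} → ¬ B x → ¬ B y → Walk E Mono x y → Walk Contracted Mono₁ x y
          contract x∉B y∉B [ p ]        = [ mono₁ x∉B p ]
          contract x∉B y∉B (cons p e w) with contract-cons x∉B y∉B p e w
          ... | _ , e′ , w′ = cons (mono₁ x∉B p) e′ w′

          -- The first arc is returned separately, so that a closed walk contracts to one with at
          -- least one arc.
          contract-cons : ∀ {x x′ y} → ¬ B x → ¬ B y → Mono x → E x x′ → Walk E Mono x′ y →
                          ∃[ x″ ] Contracted x x″ × Walk Contracted Mono₁ x″ y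
          contract-cons {x} {x′} x∉B y∉B p e w with B? x′ | x ≟ z
          ... | no x′∉B  | _        = _ , inj₁ (x∉B , x′∉B , e) , contract x′∉B y∉B w
          ... | yes x′∈B | yes refl with exit x′∈B y∉B w
          -- An excursion into `B` that starts at `z` also returns to `z`, so it is already a
          -- monochromatic closed walk inside `B` and `z`.
          ...   | detour , _        = ⊥-elim (no-inner (inj₂ refl) e detour)
          contract-cons x∉B y∉B p e w | yes x′∈B | no x≢z with exit x′∈B y∉B w
          ...   | detour , w′       = z , inj₂ (refl , (x∉B , x≢z) , _ , e , x′∈B ,
                                                map (λ _ _ e → e) proj₂ detour) , w′

          exit : ∀ {x y} → B x → ¬ B y → Walk E Mono x y →
                 Walk E (λ v → Mono v × Bz v) x z × Walk Contracted Mono₁ z y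
          exit x∈B y∉B [ _ ] = ⊥-elim (y∉B x∈B)
          exit x∈B y∉B (cons p e w) with closed x∈B e
          ... | inj₂ refl = cons (p , inj₁ x∈B) e [ first w , inj₂ refl ] , contract z∉B y∉B w
          ... | inj₁ x′∈B with exit x′∈B y∉B w
          ...   | detour , w′ = cons (p , inj₁ x∈B) e detour , w′

        no-outer : ∀ {x y} → ¬ B x → E x y → ¬ Walk E Mono y x
        no-outer x∉B e w with contract-cons x∉B x∉B (last w) e w
        ... | _ , e′ , w′ = acyclic₁ e′ w′

      acyclic : Acyclic E c
      acyclic {x = x} e w with B? x
      ... | no x∉B = no-outer x∉B e w
      -- A closed walk that leaves `B` is rotated to start at a vertex `t` outside `B`.
      ... | yes x∈B with splitAt (¬? ∘ B?) w
      ...   | inj₁ w′ = no-inner (inj₁ x∈B) e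
                (map (λ _ _ e → e) (λ {v} (p , ¬v∉B) → p , inj₁ (stable v ¬v∉B)) w′)
        where
        stable : ∀ v → ¬ ¬ B v → B v
        stable v ¬v∉B with B? v
        ... | yes v∈B = v∈B
        ... | no v∉B  = ⊥-elim (¬v∉B v∉B)
      ...   | inj₂ (t , t∉B , _ , [ _ ])            = t∉B x∈B
      ...   | inj₂ (t , t∉B , w₁ , cons _ e′ w₂) =
                no-outer t∉B e′ (w₂ ++ʷ cons (last w₂) e w₁)

    -- The centre of a lifted bow tie is neither in `B` nor equal to `z`, whereas `w` is one or the
    -- other. On the restricted side `w` is prescribed directly.
    outcome : ∀ w → ¬ Outside w → Outcome E w
    outcome w w-inside with contracted-outcome
    ... | inj₂ (b , b≢z , t) = inj₂ (b , b≢w , lift-bowTie b≢z t)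
      where
      b≢w : b ≢ w
      b≢w refl = w-inside (contracted-source (t .b⟶x₁) , b≢z)
    ... | inj₁ c₁ with restricted-outcome w
    ...   | inj₂ (b , b≢w , t) = inj₂ (b , b≢w , bowTie-mono (λ (_ , _ , e) → e) t)
    ...   | inj₁ c₂ = inj₁ (glue c₁ c₂)

  -- Finding a bow tie or a cut vertex

  module _
    {E : V → V → Set} (E? : Decidable₂ E) (loopless : ∀ {x} → ¬ E x x)
    {U : Subset n} (supp : Supported U E) (ih : ∀ {U′} → U′ ⊂ U → Solves U′)
    where

    -- Reversing all arcs exchanges `B` with the part outside `B` and `z`, so `w` may be assumed not
    -- to lie in the latter.
    cut-outcome : ∀ {B : V → Set} → Decidable B → ∀ {z} → ¬ B z →
                  (∀ {u v} → B u → E u v → B v ⊎ v ≡ z) →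
                  ∃[ i ] i ∈ U × B i → ∃[ o ] o ∈ U × ¬ B o × o ≢ z →
                  ∀ w → Outcome E w
    cut-outcome {B} B? {z} z∉B closed (i , i∈U , i∈B) (o , o∈U , o∉B , o≢z) w
      with ¬? (B? w) ×-dec ¬? (w ≟ z)
    ... | no w-inside = Cut.outcome E? loopless supp ih B? z∉B closed
                          (i , i∈U , i∈B) (o , o∈U , o∉B , o≢z) w w-inside
    ... | yes w-outside = outcome-flip
      (Cut.outcome (flip E?) loopless (λ e → proj₂ (supp e) , proj₁ (supp e)) ih
        (λ v → ¬? (B? v) ×-dec ¬? (v ≟ z)) (λ (_ , z≢z) → z≢z refl) closed′
        (o , o∈U , o∉B , o≢z) (i , i∈U , (λ (i∉B , _) → i∉B i∈B) , λ { refl → z∉B i∈B })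
        w (λ (¬outside , _) → ¬outside w-outside))
      where
      closed′ : ∀ {u v} → ¬ B u × u ≢ z → E v u → (¬ B v × v ≢ z) ⊎ v ≡ z
      closed′ {v = v} (u∉B , u≢z) e with v ≟ z
      ... | yes v≡z = inj₂ v≡z
      ... | no v≢z  = inj₁ ((λ v∈B → [ u∉B , u≢z ]′ (closed v∈B e)) , v≢z)

    -- If every out-neighbour of b is s, then b can be coloured last, unlike s.
    single-out : ∀ {b s x} → E b x → (∀ {y} → E b y → y ≡ s) → ∀ w → Outcome E w
    single-out {b} {s} e₀ only w with ih (x∈p⇒p-x⊂p (proj₁ (supp e₀))) E⁻? (λ (_ , _ , e) → loopless e) supp⁻ w
      where
      E⁻? : Decidable₂ (λ x y → x ≢ b × y ≢ b × E x y)
      E⁻? x y = ¬? (x ≟ b) ×-dec (¬? (y ≟ b) ×-dec E? x y)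

      supp⁻ : Supported (U - b) (λ x y → x ≢ b × y ≢ b × E x y)
      supp⁻ (x≢b , y≢b , e) = x∈p∧x≢y⇒x∈p-y (proj₁ (supp e)) x≢b
                            , x∈p∧x≢y⇒x∈p-y (proj₂ (supp e)) y≢b
    ... | inj₂ (b′ , b′≢w , t) = inj₂ (b′ , b′≢w , bowTie-mono (λ (_ , _ , e) → e) t)
    ... | inj₁ (c , acyclic)   = inj₁ (c′ , acyclic′)
      where
      c′ : V → Bool
      c′ v with v ≟ b
      ... | yes _ = not (c s)
      ... | no _  = c v

      c′-other : ∀ {v} → v ≢ b → c′ v ≡ c v
      c′-other {v} v≢b with v ≟ b
      ... | yes v≡b = ⊥-elim (v≢b v≡b)
      ... | no _    = refl

      c′-b : c′ b ≡ not (c s)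
      c′-b with b ≟ b
      ... | yes _  = refl
      ... | no b≢b = ⊥-elim (b≢b refl)

      s≢b : s ≢ b
      s≢b refl = loopless (subst (E b) (only e₀) e₀)

      source≢b : ∀ {k x y} → c′ x ≡ k → c′ y ≡ k → E x y → x ≢ b
      source≢b refl mono e refl =
        not-¬ refl (trans (sym (trans (cong c′ (only e)) (c′-other s≢b))) (trans mono c′-b))

      acyclic′ : Acyclic E c′
      acyclic′ e w = acyclic (source≢b (last w) (first w) e , proj₂ (first w⁻) , e)
        (map (λ (_ , u≢b) (_ , v≢b) e → u≢b , v≢b , e)
             (λ (cv≡k , v≢b) → trans (sym (c′-other v≢b)) cv≡k) w⁻)
        where
        -- No monochromatic arc leaves `b`, and the walk ends at `x ≢ b`, so it avoids `b`
        -- throughout.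
        w⁻ = backward (λ pu pv e _ → source≢b pu pv e) (source≢b (last w) (first w) e) w

    module _ {b x₀ : V} (e₀ : E b x₀) where

      private
        E⁻ : V → V → Set
        E⁻ x y = x ≢ b × y ≢ b × E x y

        E⁻? : Decidable₂ E⁻
        E⁻? x y = ¬? (x ≟ b) ×-dec (¬? (y ≟ b) ×-dec E? x y)

        out≢b : ∀ {x} → E b x → x ≢ b
        out≢b e refl = loopless e

      -- Unless `s` is the only out-neighbour of `b`, it is a cut vertex: from what `b` reaches
      -- around `s`, no arc returns to `b`, since it would complete a walk that `s` fails to
      -- separate.
      separated-outcome : ∀ {s} → s ≢ b → Separates E⁻ (E b) (flip E b) s → ∀ w → Outcome E w
      separated-outcome {s} s≢b sep with any? (λ x → E? b x ×-dec ¬? (x ≟ s))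
      ... | no none = single-out e₀ only
        where
        only : ∀ {y} → E b y → y ≡ s
        only {y} e with y ≟ s
        ... | yes y≡s = y≡s
        ... | no y≢s  = ⊥-elim (none (y , e , y≢s))
      ... | yes (x , e , x≢s) = cut-outcome reach? s∉ closed
              (x , proj₂ (supp e) , x , e , [ x≢s , out≢b e ])
              (b , proj₁ (supp e) , (λ (_ , _ , w) → proj₂ (last w) refl) , s≢b ∘ sym)
        where
        Away : V → Set
        Away v = v ≢ s × v ≢ b

        B : V → Set
        B v = ∃[ x ] E b x × Walk E Away x v

        reach? : Decidable B
        reach? v = any? (λ x → E? b x ×-dec walk? E? (λ v → ¬? (v ≟ s) ×-dec ¬? (v ≟ b)) x v)

        s∉ : ¬ B s
        s∉ (_ , _ , w) = proj₁ (last w) refl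

        closed : ∀ {u v} → B u → E u v → B v ⊎ v ≡ s
        closed {v = v} (x , e , w) e′ with v ≟ s | v ≟ b
        ... | yes v≡s | _        = inj₂ v≡s
        ... | no v≢s  | no v≢b   = inj₁ (x , e , snoc w e′ (v≢s , v≢b))
        ... | no _    | yes refl =
              ⊥-elim (sep e e′ (map (λ (_ , u≢b) (_ , v≢b) e → u≢b , v≢b , e) proj₁ w))

      -- The walks close up through `b`, so only a link is missing for a bow tie. If there is none,
      -- the vertices reached from `t .p₀` around `b` miss `t .q₁` and have arcs out only to `b`,
      -- which is then a cut vertex.
      twoWalks-outcome : ∀ {w} → b ≢ w → TwoWalks E⁻ (E b) (flip E b) → Outcome E w
      twoWalks-outcome {w} b≢w t with walk? E? (λ v → ¬? (v ≟ b)) (t .p₀) (t .q₁)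
      ... | yes link = inj₂ (b , b≢w , record
        { P = λ v → t .P v × v ≢ b
        ; Q = λ v → t .Q v × v ≢ b
        ; disjoint = λ (p , _) (q , _) → t .disjoint p q
        ; b∉P = λ (_ , b≢b) → b≢b refl
        ; b∉Q = λ (_ , b≢b) → b≢b refl
        ; b⟶x₁ = t .a∈A ; y₁⟶b = t .b∈B ; b⟶x₂ = t .a′∈A ; y₂⟶b = t .b′∈B
        ; p-walk = avoid (t .a∈A) (t .p-walk)
        ; q-walk = avoid (t .a′∈A) (t .q-walk)
        ; link = link })
        where
        avoid : ∀ {P : V → Set} {x y} → E b x → Walk E⁻ P x y → Walk E (λ v → P v × v ≢ b) x y
        avoid e w = map (λ _ _ (_ , _ , e) → e) id
                        (forward (λ _ _ (_ , v≢b , _) _ → v≢b) (out≢b e) w)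
      ... | no ¬link = cut-outcome (walk? E? (λ v → ¬? (v ≟ b)) (t .p₀))
              (λ w → last w refl) closed
              (_ , proj₂ (supp (t .a∈A)) , [ out≢b (t .a∈A) ])
              (_ , proj₁ (supp (t .b′∈B)) , ¬link , λ { refl → loopless (t .b′∈B) }) w
        where
        closed : ∀ {u v} → Walk E (_≢ b) (t .p₀) u → E u v → Walk E (_≢ b) (t .p₀) v ⊎ v ≡ b
        closed {v = v} w e with v ≟ b
        ... | yes v≡b = inj₂ v≡b
        ... | no v≢b  = inj₁ (snoc w e v≢b)

      outcome-at : ∀ {w} → b ≢ w → Outcome E w
      outcome-at {w} b≢w with menger E⁻? w (E? b) (λ y → E? y b)
      ... | inj₁ t = twoWalks-outcome b≢w t
      ... | inj₂ (s , sep) with s ≟ b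
      ...   | no s≢b   = separated-outcome s≢b sep w
      -- A separator equal to b means that no walk exists, so w separates as well.
      ...   | yes refl = separated-outcome (b≢w ∘ sym) sep′ w
        where
        sep′ : Separates E⁻ (E b) (flip E b) w
        sep′ e e′ p = sep e e′ (map (λ _ _ → id) proj₂
                                 (forward (λ _ _ (_ , v≢b , _) _ → v≢b) (out≢b e) p))

  solve : ∀ U → Acc _⊂_ U → Solves U
  solve U (acc rs) {E} E? loopless supp w
    with any? (λ b → ¬? (b ≟ w) ×-dec any? (E? b))
  ... | yes (b , b≢w , _ , e) =
        outcome-at E? loopless supp (λ U′⊂U → solve _ (rs U′⊂U)) e b≢w
  -- All arcs start at `w`, so none follows another and one colour suffices.
  ... | no none = inj₁ ((λ _ → true) , acyclic)
    where
    source≡w : ∀ {x y} → E x y → x ≡ w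
    source≡w {x} e with x ≟ w
    ... | yes x≡w = x≡w
    ... | no x≢w  = ⊥-elim (none (x , x≢w , _ , e))

    acyclic : Acyclic E (λ _ → true)
    acyclic e [ _ ]         = loopless e
    acyclic e (cons _ e′ _) with source≡w e | source≡w e′
    ... | refl | refl = loopless e

-- From bow ties to subdivisions

unique-++ʳ : ∀ {A : Set} (l : List A) {r} → Unique (l ++ r) → Unique r
unique-++ʳ []      u       = u
unique-++ʳ (_ ∷ l) (_ ∷ u) = unique-++ʳ l u

unique-++-disjoint : ∀ {A : Set} {l r : List A} {v} → Unique (l ++ r) → v ∈ˡ l → ¬ v ∈ˡ r
unique-++-disjoint {l = _ ∷ l} u       (here refl) v∈r = Unique[x∷xs]⇒x∉xs u (∈-++⁺ʳ l v∈r)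
unique-++-disjoint             (_ ∷ u) (there v∈l) v∈r = unique-++-disjoint u v∈l v∈r

lookup-injective : ∀ {A : Set} {l : List A} → Unique l → ∀ i j → lookup l i ≡ lookup l j → i ≡ j
lookup-injective {l = _ ∷ _} u       zero    zero    _  = refl
lookup-injective {l = _ ∷ l} u       zero    (suc j) eq =
  ⊥-elim (Unique[x∷xs]⇒x∉xs u (subst (_∈ˡ l) (sym eq) (∈-lookup j)))
lookup-injective {l = _ ∷ l} u       (suc i) zero    eq =
  ⊥-elim (Unique[x∷xs]⇒x∉xs u (subst (_∈ˡ l) eq (∈-lookup i)))
lookup-injective {l = _ ∷ _} (_ ∷ u) (suc i) (suc j) eq = cong suc (lookup-injective u i j eq)

module _ {V : Set} (E : V → V → Set) where

  -- The list holds the interior vertices only, as for a subdivided arc. In `Trail` it holds all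
  -- vertices after the first.
  Chain : V → List V → V → Set
  Chain u []      v = E u v
  Chain u (x ∷ l) v = E u x × Chain x l v

  data Trail : V → List V → V → Set where
    []  : ∀ {x} → Trail x [] x
    _∷_ : ∀ {x y z l} → E x y → Trail y l z → Trail x (y ∷ l) z

  SimpleTrail : (V → Set) → V → V → Set
  SimpleTrail P x y = ∃[ l ] Trail x l y × Unique (x ∷ l) × All P (x ∷ l)

module _ {V : Set} {E : V → V → Set} where

  chain-split : ∀ l {u a r v} → Chain E u (l ++ a ∷ r) v → Chain E u l a × Chain E a r v
  chain-split []      (e , c) = e , c
  chain-split (_ ∷ l) (e , c) with chain-split l c
  ... | c₁ , c₂ = (e , c₁) , c₂

  trail⇒chain : ∀ {u x l y v} → E u x → Trail E x l y → E y v → Chain E u (x ∷ l) v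
  trail⇒chain e []       e′ = e , e′
  trail⇒chain e (e″ ∷ t) e′ = e , trail⇒chain e″ t e′

  trail-last : ∀ {x l y} → Trail E x l y → y ∈ˡ (x ∷ l)
  trail-last []      = here refl
  trail-last (_ ∷ t) = there (trail-last t)

  suffix : ∀ {P x l y t} → t ∈ˡ (x ∷ l) → Trail E x l y → Unique (x ∷ l) → All P (x ∷ l) →
           SimpleTrail E P t y
  suffix (here refl) tr       u       p       = _ , tr , u , p
  suffix (there t∈)  (_ ∷ tr) (_ ∷ u) (_ ∷ p) = suffix t∈ tr u p

-- Roles 0, 1, 2 in the pattern: centre of the first arm, hub, centre of the second
-- arm; the arc from 2 to 0 is the missing one.
data RoleArc : Fin 3 → Fin 3 → Set where
  r10 : RoleArc (suc zero) zero
  r01 : RoleArc zero (suc zero)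
  r12 : RoleArc (suc zero) (suc (suc zero))
  r21 : RoleArc (suc (suc zero)) (suc zero)
  r02 : RoleArc zero (suc (suc zero))

roleArc? : Decidable₂ RoleArc
roleArc? zero             zero             = no λ ()
roleArc? zero             (suc zero)       = yes r01
roleArc? zero             (suc (suc zero)) = yes r02
roleArc? (suc zero)       zero             = yes r10
roleArc? (suc zero)       (suc zero)       = no λ ()
roleArc? (suc zero)       (suc (suc zero)) = yes r12
roleArc? (suc (suc zero)) zero             = no λ ()
roleArc? (suc (suc zero)) (suc zero)       = yes r21
roleArc? (suc (suc zero)) (suc (suc zero)) = no λ ()

data Part : Set where
  pre mid post : Part

-- Eight labels for disjoint sets of vertices: `hub` and the two `mid` parts hold the branch
-- vertices, the other five hold the interiors of the five subdivided arcs.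
data Key : Set where
  hub bridge : Key
  arm        : Bool → Part → Key

roleKey : Fin 3 → Key
roleKey zero             = arm true mid
roleKey (suc zero)       = hub
roleKey (suc (suc zero)) = arm false mid

roleKey-injective : ∀ i j → roleKey i ≡ roleKey j → i ≡ j
roleKey-injective zero             zero             _  = refl
roleKey-injective zero             (suc zero)       ()
roleKey-injective zero             (suc (suc zero)) ()
roleKey-injective (suc zero)       zero             ()
roleKey-injective (suc zero)       (suc zero)       _  = refl
roleKey-injective (suc zero)       (suc (suc zero)) ()
roleKey-injective (suc (suc zero)) zero             ()
roleKey-injective (suc (suc zero)) (suc zero)       ()
roleKey-injective (suc (suc zero)) (suc (suc zero)) _  = refl

arcKey : ∀ {i j} → RoleArc i j → Key
arcKey r10 = arm true pre
arcKey r01 = arm true post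
arcKey r12 = arm false pre
arcKey r21 = arm false post
arcKey r02 = bridge

-- The value at keys that belong to no arc is irrelevant.
keyArc : Key → Fin 3 × Fin 3
keyArc (arm true pre)   = suc zero , zero
keyArc (arm true post)  = zero , suc zero
keyArc (arm false pre)  = suc zero , suc (suc zero)
keyArc (arm false post) = suc (suc zero) , suc zero
keyArc _                = zero , suc (suc zero)

keyArc-arcKey : ∀ {i j} (r : RoleArc i j) → keyArc (arcKey r) ≡ (i , j)
keyArc-arcKey r10 = refl
keyArc-arcKey r01 = refl
keyArc-arcKey r12 = refl
keyArc-arcKey r21 = refl
keyArc-arcKey r02 = refl

arcKey≢roleKey : ∀ {i j} (r : RoleArc i j) k → arcKey r ≢ roleKey k
arcKey≢roleKey r10 zero             ()
arcKey≢roleKey r10 (suc zero)       ()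
arcKey≢roleKey r10 (suc (suc zero)) ()
arcKey≢roleKey r01 zero             ()
arcKey≢roleKey r01 (suc zero)       ()
arcKey≢roleKey r01 (suc (suc zero)) ()
arcKey≢roleKey r12 zero             ()
arcKey≢roleKey r12 (suc zero)       ()
arcKey≢roleKey r12 (suc (suc zero)) ()
arcKey≢roleKey r21 zero             ()
arcKey≢roleKey r21 (suc zero)       ()
arcKey≢roleKey r21 (suc (suc zero)) ()
arcKey≢roleKey r02 zero             ()
arcKey≢roleKey r02 (suc zero)       ()
arcKey≢roleKey r02 (suc (suc zero)) ()

module _ {n : ℕ} where

  private
    V = Fin n

  open DecMembership (_≟_ {n}) using (_∈?_)

  -- Loop erasure: if the first vertex recurs in the simplified rest, only the suffix from there is
  -- kept.
  simplify : ∀ {E P} {x y : V} → Walk E P x y → SimpleTrail E P x y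
  simplify [ p ] = [] , [] , [] ∷ [] , p ∷ []
  simplify {x = x} (cons {y = y} p e w) with simplify w
  ... | l , t , u , ps with x ∈? (y ∷ l)
  ...   | yes x∈ = suffix x∈ t u ps
  ...   | no x∉  = y ∷ l , e ∷ t , ¬Any⇒All¬ _ x∉ ∷ u , p ∷ ps

  module _ (E : V → V → Set) (b : V) where

    -- A closed walk through `b` with `b` left out, split at the vertex where the link attaches.
    record Arm : Set where
      field
        before : List V
        centre : V
        after  : List V
        unique : Unique (before ++ centre ∷ after)
        into   : Chain E b before centre
        out    : Chain E centre after b

      vertices : List V
      vertices = before ++ centre ∷ after

      part : Part → List V
      part pre  = before
      part mid  = centre ∷ []
      part post = after

      part⊆vertices : ∀ p {v} → v ∈ˡ part p → v ∈ˡ vertices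
      part⊆vertices pre  v∈          = ∈-++⁺ˡ v∈
      part⊆vertices mid  (here refl) = ∈-++⁺ʳ before (here refl)
      part⊆vertices post v∈          = ∈-++⁺ʳ before (there v∈)

      part-unique : ∀ p → Unique (part p)
      part-unique pre  = unique-++ˡ before unique
        where
        unique-++ˡ : ∀ (l : List V) {r} → Unique (l ++ r) → Unique l
        unique-++ˡ []      _        = []
        unique-++ˡ (_ ∷ l) (x∉ ∷ u) = ++⁻ˡ l x∉ ∷ unique-++ˡ l u
      part-unique mid  = [] ∷ []
      part-unique post with unique-++ʳ before unique
      ... | _ ∷ u = u

      part-disjoint : ∀ p q {v} → v ∈ˡ part p → v ∈ˡ part q → p ≡ q
      part-disjoint pre  pre  _           _           = refl
      part-disjoint pre  mid  v∈          (here refl) = ⊥-elim (unique-++-disjoint unique v∈ (here refl))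
      part-disjoint pre  post v∈          v∈′         = ⊥-elim (unique-++-disjoint unique v∈ (there v∈′))
      part-disjoint mid  pre  (here refl) v∈          = ⊥-elim (unique-++-disjoint unique v∈ (here refl))
      part-disjoint mid  mid  _           _           = refl
      part-disjoint mid  post (here refl) v∈          = ⊥-elim (Unique[x∷xs]⇒x∉xs (unique-++ʳ before unique) v∈)
      part-disjoint post pre  v∈          v∈′         = ⊥-elim (unique-++-disjoint unique v∈′ (there v∈))
      part-disjoint post mid  v∈          (here refl) = ⊥-elim (Unique[x∷xs]⇒x∉xs (unique-++ʳ before unique) v∈)
      part-disjoint post post _           _           = refl

    open Arm

    record SimpleBowTie : Set where
      field
        side          : Bool → Arm
        linkage       : List V
        arms-disjoint : ∀ {v} → v ∈ˡ vertices (side true) → ¬ v ∈ˡ vertices (side false)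
        b∉arm         : ∀ s → ¬ b ∈ˡ vertices (side s)
        b∉linkage     : ¬ b ∈ˡ linkage
        linkage∉arm   : ∀ s {v} → v ∈ˡ linkage → ¬ v ∈ˡ vertices (side s)
        linkage-uniq  : Unique linkage
        linkage-chain : Chain E (centre (side true)) linkage (centre (side false))

    armAt : ∀ {P x y a} → E b x → E y b → ((l , _) : SimpleTrail E P x y) → a ∈ˡ (x ∷ l) →
            Σ[ A ∈ Arm ] centre A ≡ a × vertices A ≡ x ∷ l
    armAt {x = x} e e′ (l , t , u , _) a∈ with ∈-∃++ a∈
    ... | before , after , eq with chain-split before (subst (λ l → Chain E b l b) eq (trail⇒chain e t e′))
    ...   | into , out = record { before = before ; after = after ; unique = subst Unique eq u
                                ; into = into ; out = out } , refl , sym eq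

    -- After loop erasure of the two closed walks, the link is trimmed to run from its last vertex
    -- on the first to its next vertex on the second. These two vertices become the centres.
    bowTie⇒simple : BowTie E b → SimpleBowTie
    bowTie⇒simple t = result
      where
      open BowTie t
      σ = simplify p-walk
      τ = simplify q-walk
      ps = x₁ ∷ proj₁ σ
      qs = x₂ ∷ proj₁ τ

      allP : ∀ {v} → v ∈ˡ ps → P v
      allP = All.lookup (proj₂ (proj₂ (proj₂ σ)))

      allQ : ∀ {v} → v ∈ˡ qs → Q v
      allQ = All.lookup (proj₂ (proj₂ (proj₂ τ)))

      y₂∈qs : y₂ ∈ˡ qs
      y₂∈qs = trail-last (proj₁ (proj₂ τ))

      Free : V → Set
      Free v = (v ≢ b × ¬ v ∈ˡ ps) × ¬ v ∈ˡ qs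

      link′ : ∃[ a ] ∃[ c ] a ∈ˡ ps × c ∈ˡ qs × ∃[ m ] Unique m × All Free m × Chain E a m c
      link′ with lastExit (_∈? ps) (λ y₂∈ps → disjoint (allP y₂∈ps) (allQ y₂∈qs)) link
      ... | inj₁ w = ⊥-elim (proj₂ (first w) (here refl))
      ... | inj₂ (a , t , a∈ , e , w) with t ∈? qs
      ...   | yes t∈ = a , t , a∈ , t∈ , [] , [] , [] , e
      ...   | no t∉ with firstEntry (_∈? qs) t∉ y₂∈qs w
      ...     | _ , c , w′ , e′ , c∈ with simplify w′
      ...       | l , tr , u , free = a , c , a∈ , c∈ , t ∷ l , u , free , trail⇒chain e tr e′

      result : SimpleBowTie
      result with link′
      ... | a , c , a∈ , c∈ , m , u , free , chain
        with armAt b⟶x₁ y₁⟶b σ a∈ | armAt b⟶x₂ y₂⟶b τ c∈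
      ...   | A , refl , eqA | C , refl , eqC = record
        { side          = λ { true → A ; false → C }
        ; linkage       = m
        ; arms-disjoint = λ v∈ v∈′ → disjoint (allP (subst (_ ∈ˡ_) eqA v∈)) (allQ (subst (_ ∈ˡ_) eqC v∈′))
        ; b∉arm         = λ { true → λ b∈ → b∉P (allP (subst (_ ∈ˡ_) eqA b∈))
                            ; false → λ b∈ → b∉Q (allQ (subst (_ ∈ˡ_) eqC b∈)) }
        ; b∉linkage     = λ b∈ → proj₁ (proj₁ (All.lookup free b∈)) refl
        ; linkage∉arm   = λ { true → λ v∈ v∈A → proj₂ (proj₁ (All.lookup free v∈)) (subst (_ ∈ˡ_) eqA v∈A)
                            ; false → λ v∈ v∈C → proj₂ (All.lookup free v∈) (subst (_ ∈ˡ_) eqC v∈C) }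
        ; linkage-uniq  = u
        ; linkage-chain = chain
        }

  module Cells {E : V → V → Set} {b : V} (t : SimpleBowTie E b) where

    private
      module T = SimpleBowTie t
      module A (s : Bool) = Arm (T.side s)

    cell : Key → List V
    cell hub       = b ∷ []
    cell bridge      = T.linkage
    cell (arm s p) = A.part s p

    cell-unique : ∀ k → Unique (cell k)
    cell-unique hub       = [] ∷ []
    cell-unique bridge      = T.linkage-uniq
    cell-unique (arm s p) = A.part-unique s p

    cell-disjoint : ∀ k k′ {v} → v ∈ˡ cell k → v ∈ˡ cell k′ → k ≡ k′
    cell-disjoint hub hub _ _ = refl
    cell-disjoint hub bridge (here refl) v∈ = ⊥-elim (T.b∉linkage v∈)
    cell-disjoint hub (arm s p) (here refl) v∈ = ⊥-elim (T.b∉arm s (A.part⊆vertices s p v∈))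
    cell-disjoint bridge hub v∈ (here refl) = ⊥-elim (T.b∉linkage v∈)
    cell-disjoint bridge bridge _ _ = refl
    cell-disjoint bridge (arm s p) v∈ v∈′ = ⊥-elim (T.linkage∉arm s v∈ (A.part⊆vertices s p v∈′))
    cell-disjoint (arm s p) hub v∈ (here refl) = ⊥-elim (T.b∉arm s (A.part⊆vertices s p v∈))
    cell-disjoint (arm s p) bridge v∈ v∈′ = ⊥-elim (T.linkage∉arm s v∈′ (A.part⊆vertices s p v∈))
    cell-disjoint (arm true p) (arm true q) v∈ v∈′ = cong (arm true) (A.part-disjoint true p q v∈ v∈′)
    cell-disjoint (arm false p) (arm false q) v∈ v∈′ = cong (arm false) (A.part-disjoint false p q v∈ v∈′)
    cell-disjoint (arm true p) (arm false q) v∈ v∈′ =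
      ⊥-elim (T.arms-disjoint (A.part⊆vertices true p v∈) (A.part⊆vertices false q v∈′))
    cell-disjoint (arm false p) (arm true q) v∈ v∈′ =
      ⊥-elim (T.arms-disjoint (A.part⊆vertices true q v∈′) (A.part⊆vertices false p v∈))

    roleVertex : Fin 3 → V
    roleVertex zero             = A.centre true
    roleVertex (suc zero)       = b
    roleVertex (suc (suc zero)) = A.centre false

    roleVertex∈cell : ∀ i → roleVertex i ∈ˡ cell (roleKey i)
    roleVertex∈cell zero             = here refl
    roleVertex∈cell (suc zero)       = here refl
    roleVertex∈cell (suc (suc zero)) = here refl

    roleArc-chain : ∀ {i j} (r : RoleArc i j) →
                    Chain E (roleVertex i) (cell (arcKey r)) (roleVertex j)
    roleArc-chain r10 = A.into true
    roleArc-chain r01 = A.out true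
    roleArc-chain r12 = A.into false
    roleArc-chain r21 = A.out false
    roleArc-chain r02 = T.linkage-chain

-- role s t labels the vertices of the bioriented triangle without the arc from s
-- to t as in RoleArc.
role : Fin 3 → Fin 3 → Fin 3 → Fin 3
role s t v = if does (v ≟ s) then suc (suc zero) else if does (v ≟ t) then zero else suc zero

abstract
  -- This and `role-arc` are settled by checking all cases over `Fin 3`, which treats every choice
  -- of the deleted arc at once.
  role-injective : ∀ s t → s ≢ t → ∀ x y → role s t x ≡ role s t y → x ≡ y
  role-injective = from-yes (all? λ s → all? λ t → ¬? (s ≟ t) →-dec
    (all? λ x → all? λ y → (role s t x ≟ role s t y) →-dec (x ≟ y)))

  role-arc : ∀ s t → s ≢ t → ∀ x y →
             T (not (does (x ≟ y)) ∧ not (does (x ≟ s) ∧ does (y ≟ t))) →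
             RoleArc (role s t x) (role s t y)
  role-arc = from-yes (all? λ s → all? λ t → ¬? (s ≟ t) →-dec (all? λ x → all? λ y →
    T? (not (does (x ≟ y)) ∧ not (does (x ≟ s) ∧ does (y ≟ t))) →-dec
    roleArc? (role s t x) (role s t y)))

arc-≡ : ∀ {F : Digraph} (a a′ : Arc F) → source a ≡ source a′ → target a ≡ target a′ → a ≡ a′
arc-≡ (arc s t p) (arc .s .t q) refl refl = cong (arc s t) (T-irrelevant p q)

-- The chain runs along the vector Subdivision.path.
chain-step : ∀ {V W : Set} {E : V → V → Set} (φ : W → V) {x y : W} (l : List V)
             (f : Fin (length l) → W) → (∀ i → φ (f i) ≡ lookup l i) → Chain E (φ x) l (φ y) →
             (i : Fin (1 + length l)) →
             E (φ (Vec.lookup (x Vec.∷ (Vec.tabulate f Vec.∷ʳ y)) (inject₁ i)))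
               (φ (Vec.lookup (x Vec.∷ (Vec.tabulate f Vec.∷ʳ y)) (suc i)))
chain-step φ []      f eq e       zero    = e
chain-step {E = E} φ {x} (_ ∷ _) f eq (e , _) zero = subst (E (φ x)) (sym (eq zero)) e
chain-step {E = E} φ {y = y} (_ ∷ l) f eq (_ , c) (suc i) =
  chain-step φ l (f ∘ suc) (eq ∘ suc) (subst (λ u → Chain E u l (φ y)) (sym (eq zero)) c) i

-- Each arc is subdivided by the vertices of its cell. Since cells with different keys are disjoint
-- and the key determines the arc, the embedding is injective.
simpleBowTie⇒subdivision :
  ∀ {D : Digraph} {b} (e : Arc biorientedTriangle) →
  SimpleBowTie (Digraph._⟶_ D) b → ContainsSubdivision D (biorientedTriangle -ᵃ e)
simpleBowTie⇒subdivision {D} e t = record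
  { ℓ              = λ a → length (cell (key a))
  ; embed          = embed
  ; embed-inj      = λ {u} {v} → embed-injective u v
  ; embed-preserve = preserve
  }
  where
  open Cells t
  F = biorientedTriangle -ᵃ e

  π : Fin 3 → Fin 3
  π = role (source e) (target e)

  s≢t : source e ≢ target e
  s≢t eq = Digraph.loopless biorientedTriangle (source e) (subst (λ v → T (not (does (source e ≟ v)))) (sym eq) (isArc e))

  π-injective : ∀ x y → π x ≡ π y → x ≡ y
  π-injective = role-injective (source e) (target e) s≢t

  roleArc : (a : Arc F) → RoleArc (π (source a)) (π (target a))
  roleArc a = role-arc (source e) (target e) s≢t (source a) (target a) (isArc a)

  key : Arc F → Key
  key a = arcKey (roleArc a)

  open Subdivision F (λ a → length (cell (key a)))

  embed : SubVertex → Vertex D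
  embed (branch x)     = roleVertex (π x)
  embed (internal a i) = lookup (cell (key a)) i

  branch≢internal : ∀ x a i → embed (branch x) ≢ embed (internal a i)
  branch≢internal x a i eq = arcKey≢roleKey (roleArc a) (π x) (cell-disjoint (key a) (roleKey (π x))
    (∈-lookup i) (subst (_∈ˡ cell (roleKey (π x))) eq (roleVertex∈cell (π x))))

  key-injective : ∀ a a′ → key a ≡ key a′ → a ≡ a′
  key-injective a a′ eq = arc-≡ a a′ (π-injective _ _ (cong proj₁ ends)) (π-injective _ _ (cong proj₂ ends))
    where
    ends : (π (source a) , π (target a)) ≡ (π (source a′) , π (target a′))
    ends = trans (sym (keyArc-arcKey (roleArc a))) (trans (cong keyArc eq) (keyArc-arcKey (roleArc a′)))

  embed-injective : ∀ u v → embed u ≡ embed v → u ≡ v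
  embed-injective (branch x) (branch y) eq = cong branch (π-injective x y (roleKey-injective (π x) (π y)
    (cell-disjoint _ _ (roleVertex∈cell (π x))
      (subst (_∈ˡ cell (roleKey (π y))) (sym eq) (roleVertex∈cell (π y))))))
  embed-injective (branch x) (internal a i) eq = ⊥-elim (branch≢internal x a i eq)
  embed-injective (internal a i) (branch x) eq = ⊥-elim (branch≢internal x a i (sym eq))
  embed-injective (internal a i) (internal a′ j) eq
    with key-injective a a′ (cell-disjoint _ _ (∈-lookup i)
           (subst (_∈ˡ cell (key a′)) (sym eq) (∈-lookup j)))
  ... | refl = cong (internal a) (lookup-injective (cell-unique (key a)) i j eq)

  preserve : ∀ {u v} → SubArc u v → Digraph._⟶_ D (embed u) (embed v)
  preserve (step a i) = chain-step embed (cell (key a)) (internal a) (λ _ → refl) (roleArc-chain (roleArc a)) i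

-- Upper bound: from closed walks to directed cycles

cycle⇒closedWalk : ∀ {D : Digraph} {P} → DirectedCycleIn D P →
                   ∃[ x ] ∃[ y ] Digraph._⟶_ D x y × Walk (Digraph._⟶_ D) P y x
cycle⇒closedWalk {D} {P} cycle = _ , _ , close , walk (suc length-2) vertex inside step
  where
  open DirectedCycleIn cycle
  open Digraph D using (_⟶_)
  walk : ∀ m (f : Fin (suc m) → Vertex D) → (∀ i → P (f i)) →
         (∀ i → f (inject₁ i) ⟶ f (suc i)) → Walk _⟶_ P (f zero) (f (fromℕ m))
  walk zero    f p e = [ p zero ]
  walk (suc m) f p e = cons (p zero) (e zero) (walk m (f ∘ suc) (p ∘ suc) (e ∘ suc))

twoColorable⇒acyclicallyColorable : ∀ {D : Digraph} → TwoColorable (Digraph._⟶_ D) →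
                                    AcyclicallyColorable D 2
twoColorable⇒acyclicallyColorable {D} (c , acyclic) = toFin ∘ c , no-cycle
  where
  toFin : Bool → Fin 2
  toFin true  = zero
  toFin false = suc zero

  toFin-injective : ∀ {p q} → toFin p ≡ toFin q → p ≡ q
  toFin-injective {true}  {true}  _ = refl
  toFin-injective {false} {false} _ = refl

  no-cycle : IsAcyclicColoring D 2 (toFin ∘ c)
  no-cycle i cycle with cycle⇒closedWalk cycle
  ... | x , y , e , w = acyclic {k = c x} e
          (map (λ _ _ e → e) (λ cv≡i → toFin-injective (trans cv≡i (sym (last w)))) w)

forces : ∀ e → ForcesSubdivision (biorientedTriangle -ᵃ e) 3
forces e D χ (_ , least) 3≤χ
  -- The prescribed vertex is arbitrary here; `zero` exists because digraphs are nonempty.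
  with solve ⊤ (⊂-wellFounded _) (λ x y → T? (Digraph.adjacent D x y))
         (λ {x} → Digraph.loopless D x) (λ _ → ∈⊤ , ∈⊤) zero
... | inj₁ colorable    = ⊥-elim (1+n≰n (≤-trans 3≤χ (least 2 (twoColorable⇒acyclicallyColorable colorable))))
... | inj₂ (b , _ , t) = simpleBowTie⇒subdivision e (bowTie⇒simple _ b t)

-- Lower bound: the digon

digon : Digraph
digon = record
  { order-1  = 1
  ; adjacent = λ x y → not (does (x ≟ y))
  ; loopless = λ { zero () ; (suc zero) () }
  }

digon-dichromatic : IsDichromaticNumber digon 2
digon-dichromatic = (id , acyclic) , least
  where
  acyclic : IsAcyclicColoring digon 2 id
  acyclic i cycle with distinct {zero} {suc zero} (trans (inside zero) (sym (inside (suc zero))))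
    where open DirectedCycleIn cycle
  ... | ()

  least : ∀ j → AcyclicallyColorable digon j → 2 ≤ j
  least zero          (c , _) with () ← c zero
  -- With one colour, the digon itself is a monochromatic cycle.
  least (suc zero)    (c , acyclic) = ⊥-elim (acyclic zero record
    { length-2 = 0 ; vertex = id ; distinct = id ; inside = λ i → only (c i)
    ; step = λ { zero → _ } ; close = _ })
    where
    only : (i : Fin 1) → i ≡ zero
    only zero = refl
  least (suc (suc j)) _ = s≤s (s≤s z≤n)

-- Three branch vertices do not fit into two vertices.
¬digon-contains : ∀ e → ¬ ContainsSubdivision digon (biorientedTriangle -ᵃ e)
¬digon-contains e t = 1+n≰n (injective⇒≤ {f = embed ∘ branch} (branch-injective ∘ embed-inj))
  where
  open ContainsSubdivision t
  open Subdivision _ ℓ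
  branch-injective : ∀ {x y} → branch x ≡ branch y → x ≡ y
  branch-injective refl = refl

proposition10 : (e : Arc biorientedTriangle) → IsMaderNumber (biorientedTriangle -ᵃ e) 3
proposition10 e = (s≤s z≤n , forces e) , least
  where
  least : ∀ j → 1 ≤ j × ForcesSubdivision (biorientedTriangle -ᵃ e) j → 3 ≤ j
  least j (_ , forces-j) = ≰⇒> λ j≤2 → ¬digon-contains e (forces-j digon 2 digon-dichromatic j≤2)
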